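{- Let $n\ge1$, let $A=(a_1,\ldots,a_n)$ be a strictly decreasing sequence of real numbers and $B=(b_1,\ldots,b_n)$ a strictly increasing sequence of positive integers such that $a_i>b_{n+1-i}-1$ for all $i$ and $a_i\neq b_j-1$ for all $i,j$. Define $M=\mathbf{F}(A,B)=(f_{ij})_{i,j=1}^n$ by $f_{ij}=\frac{1}{(a_i)_{b_j}}$ if $a_i>b_j-1$ and $f_{ij}=0$ if $a_i<b_j-1$. Then $M$ is nonsingular. Furthermore, $\det(M)>0$ if $\omega(M)$ is even and $\det(M)<0$ if $\omega(M)$ is odd, where $\omega(M)$ is the number of zero entries of $M$.
   Context: $(a)_k=a(a-1)\cdots(a-k+1)$ denotes the falling factorial. A matrix of the form $\mathbf{F}(A,B)$ is called a factorial Cauchy matrix. -}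

module Defs where

open import Data.Nat as ℕ using (ℕ; zero; suc)
open import Data.Fin using (Fin; zero; suc; punchIn; toℕ)
open import Data.Product using (Σ; ∃; _×_; _,_)
open import Data.Sum using (_⊎_)
open import Data.Empty using (⊥)
open import Relation.Nullary using (¬_)
open import Relation.Binary.PropositionalEquality using (_≡_; _≢_)
open import Relation.Binary.Definitions using (Tri; tri<; tri≈; tri>)

-- The real numbers, axiomatised (up to isomorphism) as a complete
-- ordered field.  Every model is isomorphic to ℝ, so quantifying over
-- all models is the same as speaking about ℝ.
record RealField : Set₁ where
  infixl 6 _+_
  infixl 7 _*_
  infix  4 _<_ _≤_
  field
    Carrier : Set
    0# 1#   : Carrier
    _+_ _*_ : Carrier → Carrier → Carrier
    -_      : Carrier → Carrier
    _⁻¹     : Carrier → Carrier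
    _<_     : Carrier → Carrier → Set
    +-assoc     : ∀ x y z → (x + y) + z ≡ x + (y + z)
    +-comm      : ∀ x y → x + y ≡ y + x
    +-identityˡ : ∀ x → 0# + x ≡ x
    -‿inverseˡ  : ∀ x → (- x) + x ≡ 0#
    *-assoc     : ∀ x y z → (x * y) * z ≡ x * (y * z)
    *-comm      : ∀ x y → x * y ≡ y * x
    *-identityˡ : ∀ x → 1# * x ≡ x
    distribˡ    : ∀ x y z → x * (y + z) ≡ x * y + x * z
    0≢1         : 0# ≢ 1#
    ⁻¹-inverse  : ∀ x → x ≢ 0# → x * (x ⁻¹) ≡ 1#
    <-trans     : ∀ {x y z} → x < y → y < z → x < z
    compare     : ∀ x y → Tri (x < y) (x ≡ y) (y < x)
    +-mono-<    : ∀ {x y} z → x < y → x + z < y + z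
    *-pos       : ∀ {x y} → 0# < x → 0# < y → 0# < x * y
  _≤_ : Carrier → Carrier → Set
  x ≤ y = x < y ⊎ x ≡ y
  field
    sup : (P : Carrier → Set) → Σ Carrier P →
          Σ Carrier (λ u → ∀ x → P x → x ≤ u) →
          Σ Carrier (λ s → (∀ x → P x → x ≤ s) ×
                           (∀ u → (∀ x → P x → x ≤ u) → s ≤ u))

module _ (R : RealField) where
  open RealField R

  _-_ : Carrier → Carrier → Carrier
  x - y = x + (- y)

  fromℕ : ℕ → Carrier
  fromℕ zero    = 0#
  fromℕ (suc k) = 1# + fromℕ k

  falling : Carrier → ℕ → Carrier
  falling x zero    = 1#
  falling x (suc k) = falling x k * (x - fromℕ k)

  sumF : ∀ {n} → (Fin n → Carrier) → Carrier
  sumF {zero}  f = 0#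
  sumF {suc n} f = f zero + sumF (λ i → f (suc i))

  signℕ : ℕ → Carrier
  signℕ zero    = 1#
  signℕ (suc k) = - (signℕ k)

  det : ∀ n → (Fin n → Fin n → Carrier) → Carrier
  det zero    M = 1#
  det (suc n) M =
    sumF (λ j → signℕ (toℕ j) * (M zero j *
                 det n (λ i k → M (suc i) (punchIn j k))))

  -- factorial Cauchy matrix F(A,B): entry 1/(a_i)_{b_j} if a_i > b_j - 1,
  -- and 0 otherwise (the case a_i = b_j - 1 is excluded by hypothesis).
  factorialCauchy : ∀ {n} → (Fin n → Carrier) → (Fin n → ℕ) →
                    Fin n → Fin n → Carrier
  factorialCauchy a b i j with compare (fromℕ (b j) - 1#) (a i)
  ... | tri< _ _ _ = (falling (a i) (b j)) ⁻¹
  ... | tri≈ _ _ _ = 0#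
  ... | tri> _ _ _ = 0#

  isZero : Carrier → ℕ
  isZero x with compare x 0#
  ... | tri≈ _ _ _ = 1
  ... | tri< _ _ _ = 0
  ... | tri> _ _ _ = 0

  countℕ : ∀ {n} → (Fin n → ℕ) → ℕ
  countℕ {zero}  f = 0
  countℕ {suc n} f = f zero ℕ.+ countℕ (λ i → f (suc i))

  ω : ∀ {n} → (Fin n → Fin n → Carrier) → ℕ
  ω M = countℕ (λ i → countℕ (λ j → isZero (M i j)))

{-# OPTIONS --safe #-}

-- Replace the integers 0, 1, 2, … in the falling factorials by arbitrary
-- weakly increasing nodes z₀ ≤ z₁ ≤ …: the entry in column k is
-- 1/((a − z₀)⋯(a − z_k)) if z_k < a, and 0 otherwise.  Induct on the size by
-- eliminating the last row, that of the smallest a, say x: subtract from each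
-- column the multiple of the previous one which kills its last entry.  Up to
-- the positive row factors a_i − x, the new columns belong to the node sequence
-- with x inserted.  If the last entry was nonzero, the column becomes a negative
-- combination (by telescoping) of columns with old indices strictly above the
-- previous column's and at most its own; if it was zero, the column is unchanged
-- and acquires the additional factor a_i − x in its denominator, so that its
-- index moves up by one.  All choices of one column from each combination have
-- the same zero pattern, that of the original matrix without its last row and
-- first column, so by multilinearity the signs do not cancel, and eliminating
-- the row multiplies the sign by −1 for each of its zeros.
module Submission where

open import Defs
open import Algebra.Bundles using (CommutativeRing)
open import Data.Empty using (⊥-elim)
import Data.Nat
open import Data.Nat as ℕ using (ℕ; zero; suc; _%_; z≤n; s≤s)
import Data.Nat.Properties as ℕₚ
open import Data.Fin using (Fin; zero; suc; toℕ; inject₁; opposite; punchIn; punchOut; _≟_) renaming (_<_ to _<ᶠ_; fromℕ to last)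
open import Data.Fin.Induction using (<-weakInduction; >-weakInduction)
open import Data.Fin.Properties using (punchIn-injective; punchInᵢ≢i; punchIn-punchOut; toℕ-inject₁; toℕ-fromℕ; toℕ-injective; toℕ<n; suc-injective)
open import Data.Product using (Σ; _×_; _,_; proj₁; proj₂)
open import Data.Sum using (_⊎_; inj₁; inj₂)
open import Data.Vec.Functional using (updateAt)
open import Data.Vec.Functional.Properties using (updateAt-updates; updateAt-minimal)
open import Function using (_∘_; const)
open import Relation.Binary.Definitions using (tri<; tri≈; tri>)
open import Relation.Binary.PropositionalEquality
open import Relation.Nullary using (¬_; Dec; yes; no)

-- Ordered field arithmetic

module OrderedField (R : RealField) where
  open RealField R public

  open import Algebra.Structures {A = Carrier} _≡_ using (IsCommutativeRing)

  private
    isCommutativeRing : IsCommutativeRing _+_ _*_ (λ x → - x) 0# 1#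
    isCommutativeRing = record
      { isRing = record
        { +-isAbelianGroup = record
          { isGroup = record
            { isMonoid = record
              { isSemigroup = record { isMagma = isMagma _+_ ; assoc = +-assoc }
              ; identity = comm∧idˡ⇒id +-comm +-identityˡ }
            ; inverse = comm∧invˡ⇒inv +-comm -‿inverseˡ
            ; ⁻¹-cong = cong (λ x → - x) }
          ; comm = +-comm }
        ; *-cong = cong₂ _*_
        ; *-assoc = *-assoc
        ; *-identity = comm∧idˡ⇒id *-comm *-identityˡ
        ; distrib = distribˡ , comm∧distrˡ⇒distrʳ *-comm distribˡ }
      ; *-comm = *-comm }
      where
      open import Algebra.Consequences.Propositional
      open import Relation.Binary.PropositionalEquality.Algebra using (isMagma)

    commutativeRing : CommutativeRing _ _
    commutativeRing = record { isCommutativeRing = isCommutativeRing }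

  open CommutativeRing commutativeRing public
    using (zeroˡ; zeroʳ; +-identityʳ; *-identityʳ; -‿inverseʳ; distribʳ)
  open import Algebra.Properties.Ring (CommutativeRing.ring commutativeRing) public
    using (-‿distribˡ-*; -‿distribʳ-*; -‿involutive; -‿+-comm)
  -- The semiring solver treats negated subterms as atoms, so identities
  -- below are arranged to need no cancellation.
  open import Algebra.Solver.Ring.NaturalCoefficients.Default
    (CommutativeRing.commutativeSemiring commutativeRing) public
    using (solve; _:+_; _:*_; _:=_; con)

  open ≡-Reasoning

  <-irrefl : ∀ {x} → ¬ (x < x)
  <-irrefl {x} with compare x x
  ... | tri< _ x≢x _ = ⊥-elim (x≢x refl)
  ... | tri≈ x≮x _ _ = x≮x
  ... | tri> _ x≢x _ = ⊥-elim (x≢x refl)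

  <⇒≢0 : ∀ {x} → 0# < x → x ≢ 0#
  <⇒≢0 0<x refl = <-irrefl 0<x

  ≤-<-trans : ∀ {x y z} → x ≤ y → y < z → x < z
  ≤-<-trans (inj₁ x<y) y<z = <-trans x<y y<z
  ≤-<-trans (inj₂ refl) y<z = y<z

  ≤-refl : ∀ {x} → x ≤ x
  ≤-refl = inj₂ refl

  ≤-trans : ∀ {x y z} → x ≤ y → y ≤ z → x ≤ z
  ≤-trans x≤y (inj₁ y<z) = inj₁ (≤-<-trans x≤y y<z)
  ≤-trans x≤y (inj₂ refl) = x≤y

  ≮⇒≥ : ∀ {x y} → ¬ (x < y) → y ≤ x
  ≮⇒≥ {x} {y} x≮y with compare x y
  ... | tri< x<y _ _ = ⊥-elim (x≮y x<y)
  ... | tri≈ _ x≡y _ = inj₂ (sym x≡y)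
  ... | tri> _ _ y<x = inj₁ y<x

  _<?_ : ∀ x y → Dec (x < y)
  x <? y with compare x y
  ... | tri< x<y _ _ = yes x<y
  ... | tri≈ x≮y _ _ = no x≮y
  ... | tri> x≮y _ _ = no x≮y

  x<y⇒0<y-x : ∀ {x y} → x < y → 0# < y + - x
  x<y⇒0<y-x {x} x<y = subst (_< _) (-‿inverseʳ x) (+-mono-< (- x) x<y)

  0<x⇒-x<0 : ∀ {x} → 0# < x → - x < 0#
  0<x⇒-x<0 {x} 0<x = subst₂ _<_ (+-identityˡ _) (-‿inverseʳ x) (+-mono-< (- x) 0<x)

  x<0⇒0<-x : ∀ {x} → x < 0# → 0# < - x
  x<0⇒0<-x {x} x<0 = subst (0# <_) (+-identityˡ _) (x<y⇒0<y-x x<0)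

  +-pos : ∀ {x y} → 0# < x → 0# < y → 0# < x + y
  +-pos {x} {y} 0<x 0<y = <-trans 0<y (subst (_< x + y) (+-identityˡ y) (+-mono-< y 0<x))

  -x*-y≡x*y : ∀ x y → (- x) * (- y) ≡ x * y
  -x*-y≡x*y x y = begin
    (- x) * (- y)  ≡⟨ -‿distribˡ-* x (- y) ⟨
    - (x * (- y))  ≡⟨ cong -_ (-‿distribʳ-* x y) ⟨
    - (- (x * y))  ≡⟨ -‿involutive _ ⟩
    x * y          ∎

  0<1 : 0# < 1#
  0<1 with compare 0# 1#
  ... | tri< 0<1 _ _ = 0<1
  ... | tri≈ _ 0≡1 _ = ⊥-elim (0≢1 0≡1)
  ... | tri> _ _ 1<0 = subst (0# <_) (trans (-x*-y≡x*y 1# 1#) (*-identityˡ 1#))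
                         (*-pos (x<0⇒0<-x 1<0) (x<0⇒0<-x 1<0))

  ⁻¹-pos : ∀ {x} → 0# < x → 0# < x ⁻¹
  ⁻¹-pos {x} 0<x with compare 0# (x ⁻¹)
  ... | tri< 0<x⁻¹ _ _ = 0<x⁻¹
  ... | tri≈ _ 0≡x⁻¹ _ = ⊥-elim (0≢1 (begin
    0#        ≡⟨ zeroʳ x ⟨
    x * 0#    ≡⟨ cong (x *_) 0≡x⁻¹ ⟩
    x * x ⁻¹  ≡⟨ ⁻¹-inverse x (<⇒≢0 0<x) ⟩
    1#        ∎))
  ... | tri> _ _ x⁻¹<0 = ⊥-elim (<-irrefl (<-trans 0<1 (subst₂ _<_
      (-‿involutive 1#) refl (0<x⇒-x<0 0<-1))))
    where
    0<-1 : 0# < - 1#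
    0<-1 = subst (0# <_)
      (trans (sym (-‿distribʳ-* x (x ⁻¹))) (cong -_ (⁻¹-inverse x (<⇒≢0 0<x))))
      (*-pos 0<x (x<0⇒0<-x x⁻¹<0))

  ⁻¹-factor : ∀ {x y} → 0# < x → 0# < y → x ⁻¹ ≡ (x * y) ⁻¹ * y
  ⁻¹-factor {x} {y} 0<x 0<y = begin
    x ⁻¹                                ≡⟨ *-identityʳ _ ⟨
    x ⁻¹ * 1#                           ≡⟨ cong (x ⁻¹ *_) (⁻¹-inverse (x * y) (<⇒≢0 (*-pos 0<x 0<y))) ⟨
    x ⁻¹ * (x * y * (x * y) ⁻¹)         ≡⟨ solve 4 (λ x y x⁻¹ w → x⁻¹ :* (x :* y :* w) := x :* x⁻¹ :* (w :* y)) refl x y (x ⁻¹) ((x * y) ⁻¹) ⟩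
    x * x ⁻¹ * ((x * y) ⁻¹ * y)         ≡⟨ cong (_* ((x * y) ⁻¹ * y)) (⁻¹-inverse x (<⇒≢0 0<x)) ⟩
    1# * ((x * y) ⁻¹ * y)               ≡⟨ *-identityˡ _ ⟩
    (x * y) ⁻¹ * y                      ∎

  signℕ-+ : ∀ m n → signℕ R (m ℕ.+ n) ≡ signℕ R m * signℕ R n
  signℕ-+ zero n = sym (*-identityˡ _)
  signℕ-+ (suc m) n = trans (cong -_ (signℕ-+ m n)) (-‿distribˡ-* _ _)

  signℕ² : ∀ m → signℕ R m * signℕ R m ≡ 1#
  signℕ² zero = *-identityˡ _
  signℕ² (suc m) = trans (-x*-y≡x*y _ _) (signℕ² m)

  signℕ-parity : ∀ m → signℕ R m ≡ signℕ R (m % 2)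
  signℕ-parity zero = refl
  signℕ-parity (suc zero) = refl
  signℕ-parity (suc (suc m)) = trans (-‿involutive _) (signℕ-parity m)

  -- Finite products and sums

  prodF : ∀ {n} → (Fin n → Carrier) → Carrier
  prodF {zero} f = 1#
  prodF {suc n} f = f zero * prodF (λ i → f (suc i))

  prodF-pos : ∀ {n} (f : Fin n → Carrier) → (∀ i → 0# < f i) → 0# < prodF f
  prodF-pos {zero} f 0<f = 0<1
  prodF-pos {suc n} f 0<f = *-pos (0<f zero) (prodF-pos (f ∘ suc) (0<f ∘ suc))

  prodF-punchIn : ∀ {n} (f : Fin (suc n) → Carrier) j → prodF f ≡ f j * prodF (f ∘ punchIn j)
  prodF-punchIn f zero = refl
  prodF-punchIn {suc n} f (suc j) = begin
    f zero * prodF (f ∘ suc)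
      ≡⟨ cong (f zero *_) (prodF-punchIn (f ∘ suc) j) ⟩
    f zero * (f (suc j) * prodF (f ∘ suc ∘ punchIn j))
      ≡⟨ solve 3 (λ x y z → x :* (y :* z) := y :* (x :* z)) refl _ _ _ ⟩
    f (suc j) * (f zero * prodF (f ∘ suc ∘ punchIn j)) ∎

  sumF-cong : ∀ {n} {f g : Fin n → Carrier} → (∀ i → f i ≡ g i) → sumF R f ≡ sumF R g
  sumF-cong {zero} f≡g = refl
  sumF-cong {suc n} f≡g = cong₂ _+_ (f≡g zero) (sumF-cong (f≡g ∘ suc))

  sumF-linear : ∀ {n} c d (f g : Fin n → Carrier) →
    sumF R (λ i → c * f i + d * g i) ≡ c * sumF R f + d * sumF R g
  sumF-linear {zero} c d f g = solve 2 (λ c d → con 0 := c :* con 0 :+ d :* con 0) refl c d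
  sumF-linear {suc n} c d f g = begin
    (c * f zero + d * g zero) + sumF R (λ i → c * f (suc i) + d * g (suc i))
      ≡⟨ cong ((c * f zero + d * g zero) +_) (sumF-linear c d (f ∘ suc) (g ∘ suc)) ⟩
    (c * f zero + d * g zero) + (c * sumF R (f ∘ suc) + d * sumF R (g ∘ suc))
      ≡⟨ solve 6 (λ c d x y s t → (c :* x :+ d :* y) :+ (c :* s :+ d :* t)
                  := c :* (x :+ s) :+ d :* (y :+ t)) refl c d _ _ _ _ ⟩
    c * (f zero + sumF R (f ∘ suc)) + d * (g zero + sumF R (g ∘ suc)) ∎

  sumF-* : ∀ {n} c (f : Fin n → Carrier) → sumF R (λ i → c * f i) ≡ c * sumF R f
  sumF-* {zero} c f = sym (zeroʳ c)
  sumF-* {suc n} c f = trans (cong (c * f zero +_) (sumF-* c (f ∘ suc))) (sym (distribˡ c _ _))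

  sumF-zero : ∀ {n} {f : Fin n → Carrier} → (∀ i → f i ≡ 0#) → sumF R f ≡ 0#
  sumF-zero {zero} f≡0 = refl
  sumF-zero {suc n} f≡0 = trans (cong₂ _+_ (f≡0 zero) (sumF-zero (f≡0 ∘ suc))) (+-identityˡ 0#)

  sumF-cancel : ∀ {n} (j : Fin n) {f : Fin (suc n) → Carrier} → f (inject₁ j) + f (suc j) ≡ 0# →
    (∀ k → k ≢ inject₁ j → k ≢ suc j → f k ≡ 0#) → sumF R f ≡ 0#
  sumF-cancel zero {f} pair rest = begin
    f zero + (f (suc zero) + sumF R (λ i → f (suc (suc i))))
      ≡⟨ +-assoc _ _ _ ⟨
    f zero + f (suc zero) + sumF R (λ i → f (suc (suc i)))
      ≡⟨ cong₂ _+_ pair (sumF-zero λ i → rest (suc (suc i)) (λ ()) (λ ())) ⟩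
    0# + 0#
      ≡⟨ +-identityˡ 0# ⟩
    0# ∎
  sumF-cancel (suc j) {f} pair rest = trans
    (cong₂ _+_ (rest zero (λ ()) (λ ()))
      (sumF-cancel j pair λ k k≢j k≢sj → rest (suc k) (k≢j ∘ suc-injective) (k≢sj ∘ suc-injective)))
    (+-identityˡ 0#)

-- Determinants

module Determinant (R : RealField) where
  open OrderedField R public
  open ≡-Reasoning

  Matrix : ℕ → Set
  Matrix n = Fin n → Fin n → Carrier

  minor : ∀ {n} → Matrix (suc n) → Fin (suc n) → Matrix n
  minor M j i k = M (suc i) (punchIn j k)

  cofactorTerm : ∀ {n} → Matrix (suc n) → Fin (suc n) → Carrier
  cofactorTerm {n} M j = signℕ R (toℕ j) * (M zero j * det R n (minor M j))

  det-cong : ∀ n {M N : Matrix n} → (∀ i j → M i j ≡ N i j) → det R n M ≡ det R n N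
  det-cong zero M≡N = refl
  det-cong (suc n) M≡N = sumF-cong λ j → cong (signℕ R (toℕ j) *_)
    (cong₂ _*_ (M≡N zero j) (det-cong n λ i k → M≡N (suc i) (punchIn j k)))

  -- Induction along the first-row expansion: in term `J` the coefficient splits and the minors
  -- agree; in every other term the minor splits, with column `J` now at `punchOut k≢J`.
  det-linear : ∀ n (J : Fin n) c d {M N L : Matrix n} →
    (∀ i k → k ≢ J → M i k ≡ L i k) → (∀ i k → k ≢ J → N i k ≡ L i k) →
    (∀ i → L i J ≡ c * M i J + d * N i J) →
    det R n L ≡ c * det R n M + d * det R n N
  det-linear (suc n) J c d {M} {N} {L} M≡L N≡L L≡cM+dN =
    trans (sumF-cong term) (sumF-linear c d (cofactorTerm M) (cofactorTerm N))
    where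
    term : ∀ k → cofactorTerm L k ≡ c * cofactorTerm M k + d * cofactorTerm N k
    term k with k ≟ J
    ... | yes refl = begin
      s * (L zero J * D)
        ≡⟨ cong (λ e → s * (e * D)) (L≡cM+dN zero) ⟩
      s * ((c * M zero J + d * N zero J) * D)
        ≡⟨ solve 6 (λ s c d x y D → s :* ((c :* x :+ d :* y) :* D)
                    := c :* (s :* (x :* D)) :+ d :* (s :* (y :* D))) refl s c d _ _ D ⟩
      c * (s * (M zero J * D)) + d * (s * (N zero J * D))
        ≡⟨ cong₂ (λ D₁ D₂ → c * (s * (M zero J * D₁)) + d * (s * (N zero J * D₂)))
             (det-cong n λ i k → M≡L (suc i) _ (punchInᵢ≢i J k))
             (det-cong n λ i k → N≡L (suc i) _ (punchInᵢ≢i J k)) ⟨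
      c * cofactorTerm M J + d * cofactorTerm N J ∎
      where
      s = signℕ R (toℕ J)
      D = det R n (minor L J)
    ... | no k≢J = begin
      s * (L zero k * det R n (minor L k))
        ≡⟨ cong (λ D → s * (L zero k * D)) (det-linear n J′ c d
             (λ i l l≢J′ → M≡L (suc i) _ (off l≢J′))
             (λ i l l≢J′ → N≡L (suc i) _ (off l≢J′))
             (λ i → subst (λ j → L (suc i) j ≡ c * M (suc i) j + d * N (suc i) j)
                      (sym (punchIn-punchOut k≢J)) (L≡cM+dN (suc i)))) ⟩
      s * (L zero k * (c * DM + d * DN))
        ≡⟨ solve 6 (λ s c d x D E → s :* (x :* (c :* D :+ d :* E))
                    := c :* (s :* (x :* D)) :+ d :* (s :* (x :* E))) refl s c d _ DM DN ⟩
      c * (s * (L zero k * DM)) + d * (s * (L zero k * DN))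
        ≡⟨ cong₂ (λ x y → c * (s * (x * DM)) + d * (s * (y * DN)))
             (M≡L zero k k≢J) (N≡L zero k k≢J) ⟨
      c * cofactorTerm M k + d * cofactorTerm N k ∎
      where
      s = signℕ R (toℕ k)
      DM = det R n (minor M k)
      DN = det R n (minor N k)
      J′ = punchOut k≢J
      off : ∀ {l} → l ≢ J′ → punchIn k l ≢ J
      off l≢J′ eq = l≢J′ (punchIn-injective k _ _ (trans eq (sym (punchIn-punchOut k≢J))))

  punchIn-adjacent : ∀ {n} {A : Set} (j : Fin n) (f : Fin (suc n) → A) → f (inject₁ j) ≡ f (suc j) →
    ∀ k → f (punchIn (inject₁ j) k) ≡ f (punchIn (suc j) k)
  punchIn-adjacent zero f eq zero = sym eq
  punchIn-adjacent zero f eq (suc k) = refl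
  punchIn-adjacent (suc j) f eq zero = refl
  punchIn-adjacent (suc j) f eq (suc k) = punchIn-adjacent j (f ∘ suc) eq k

  -- Passes the hypothesis of `det-adjacent` on to minors: deleting a third column leaves the pair
  -- adjacent.
  punchIn-reaches-adjacent : ∀ {n} (j : Fin (suc n)) (k : Fin (suc (suc n))) →
    k ≢ inject₁ j → k ≢ suc j →
    Σ (Fin n) λ j′ → punchIn k (inject₁ j′) ≡ inject₁ j × punchIn k (suc j′) ≡ suc j
  punchIn-reaches-adjacent zero zero k≢j k≢sj = ⊥-elim (k≢j refl)
  punchIn-reaches-adjacent zero (suc zero) k≢j k≢sj = ⊥-elim (k≢sj refl)
  punchIn-reaches-adjacent {suc n} zero (suc (suc k)) k≢j k≢sj = zero , refl , refl
  punchIn-reaches-adjacent (suc j) zero k≢j k≢sj = j , refl , refl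
  punchIn-reaches-adjacent {suc n} (suc j) (suc k) k≢j k≢sj
    with j′ , eq₁ , eq₂ ← punchIn-reaches-adjacent j k (k≢j ∘ cong suc) (k≢sj ∘ cong suc)
    = suc j′ , cong suc eq₁ , cong suc eq₂

  -- The terms of the two equal columns have the same minor and opposite signs; every other minor
  -- again has two equal neighbouring columns and vanishes by induction.
  det-adjacent : ∀ n (J : Fin n) (M : Matrix (suc n)) → (∀ i → M i (inject₁ J) ≡ M i (suc J)) →
    det R (suc n) M ≡ 0#
  det-adjacent (suc n) J M eq = sumF-cancel J pair rest
    where
    pair : cofactorTerm M (inject₁ J) + cofactorTerm M (suc J) ≡ 0#
    pair = begin
      cofactorTerm M (inject₁ J) + - s * e
        ≡⟨ cong₂ (λ t x → t + - s * x)
             (cong (λ m → signℕ R m * (M zero (inject₁ J) * det R (suc n) (minor M (inject₁ J)))) (toℕ-inject₁ J))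
             (sym (cong₂ _*_ (eq zero) (det-cong (suc n) λ i → punchIn-adjacent J (M (suc i)) (eq (suc i))))) ⟩
      s * e′ + - s * e′
        ≡⟨ distribʳ e′ s (- s) ⟨
      (s + - s) * e′
        ≡⟨ cong (_* e′) (-‿inverseʳ s) ⟩
      0# * e′
        ≡⟨ zeroˡ e′ ⟩
      0# ∎
      where
      s = signℕ R (toℕ J)
      e = M zero (suc J) * det R (suc n) (minor M (suc J))
      e′ = M zero (inject₁ J) * det R (suc n) (minor M (inject₁ J))
    rest : ∀ k → k ≢ inject₁ J → k ≢ suc J → cofactorTerm M k ≡ 0#
    rest k k≢j k≢sj with j′ , eq₁ , eq₂ ← punchIn-reaches-adjacent J k k≢j k≢sj = begin
      s * (M zero k * det R (suc n) (minor M k))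
        ≡⟨ cong (λ D → s * (M zero k * D)) (det-adjacent n j′ (minor M k) λ i →
             trans (cong (M (suc i)) eq₁) (trans (eq (suc i)) (cong (M (suc i)) (sym eq₂)))) ⟩
      s * (M zero k * 0#)
        ≡⟨ solve 2 (λ s x → s :* (x :* con 0) := con 0) refl s (M zero k) ⟩
      0# ∎
      where s = signℕ R (toℕ k)

  -- Column operations and expansion along the last row

  subtractPrevious : ∀ {n} → (Fin n → Carrier) → Matrix (suc n) → Matrix (suc n)
  subtractPrevious c M i zero = M i zero
  subtractPrevious c M i (suc j) = M i (suc j) + - c j * M i (inject₁ j)

  -- All multiples are taken of the original columns, and the coefficients are discarded from left
  -- to right. `Claim p` assumes that those before `p` already vanish; it is proved downwards from
  -- `last n`, where none is left.
  det-subtractPrevious : ∀ {n} (c : Fin n → Carrier) (M : Matrix (suc n)) →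
    det R (suc n) (subtractPrevious c M) ≡ det R (suc n) M
  det-subtractPrevious {n} c₀ M = >-weakInduction Claim start step zero c₀ (λ _ ())
    where
    Claim : Fin (suc n) → Set
    Claim p = ∀ c → (∀ j → toℕ j ℕ.< toℕ p → c j ≡ 0#) →
      det R (suc n) (subtractPrevious c M) ≡ det R (suc n) M

    vanish : ∀ c j i → c j ≡ 0# → subtractPrevious c M i (suc j) ≡ M i (suc j)
    vanish c j i cj≡0 = begin
      M i (suc j) + - c j * M i (inject₁ j)
        -- The negation is moved to the matrix entry, so that the solver meets a literal zero
        -- instead of the atom `- 0#`.
        ≡⟨ cong (M i (suc j) +_) (trans (sym (-‿distribˡ-* _ _)) (-‿distribʳ-* _ _)) ⟩
      M i (suc j) + c j * - M i (inject₁ j)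
        ≡⟨ cong (λ d → M i (suc j) + d * - M i (inject₁ j)) cj≡0 ⟩
      M i (suc j) + 0# * - M i (inject₁ j)
        ≡⟨ solve 2 (λ x y → x :+ con 0 :* y := x) refl _ _ ⟩
      M i (suc j) ∎

    start : Claim (last n)
    start c c≡0 = det-cong (suc n) {subtractPrevious c M} {M} λ where
      i zero → refl
      i (suc j) → vanish c j i (c≡0 j (subst (toℕ j ℕ.<_) (sym (toℕ-fromℕ n)) (toℕ<n j)))

    step : ∀ J → Claim (suc J) → Claim (inject₁ J)
    step J claim c c≡0 = begin
      det R (suc n) (subtractPrevious c M)
        ≡⟨ det-linear (suc n) (suc J) 1# (- c J) off₁ off₂ at ⟩
      1# * det R (suc n) (subtractPrevious c′ M) + - c J * det R (suc n) K
        ≡⟨ cong₂ (λ D E → 1# * D + - c J * E) (claim c′ c′≡0) (det-adjacent n J K K-adjacent) ⟩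
      1# * det R (suc n) M + - c J * 0#
        ≡⟨ solve 2 (λ D y → con 1 :* D :+ y :* con 0 := D) refl _ _ ⟩
      det R (suc n) M ∎
      where
      c′ = updateAt c J (const 0#)
      -- `K` has the subtracted column in position `suc J`; its left neighbour is still the same
      -- original column, because all earlier coefficients vanish.
      K : Matrix (suc n)
      K i = updateAt (subtractPrevious c M i) (suc J) (const (M i (inject₁ J)))

      c′≡0 : ∀ j → toℕ j ℕ.< suc (toℕ J) → c′ j ≡ 0#
      c′≡0 j (s≤s j≤J) with ℕₚ.m≤n⇒m<n∨m≡n j≤J
      ... | inj₂ j≡J = subst (λ l → c′ l ≡ 0#) (toℕ-injective (sym j≡J)) (updateAt-updates J c)
      ... | inj₁ j<J = trans
        (updateAt-minimal j J c (λ j≡J → ℕₚ.<⇒≢ j<J (cong toℕ j≡J)))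
        (c≡0 j (subst (toℕ j ℕ.<_) (sym (toℕ-inject₁ J)) j<J))

      off₁ : ∀ i k → k ≢ suc J → subtractPrevious c′ M i k ≡ subtractPrevious c M i k
      off₁ i zero _ = refl
      off₁ i (suc k) k≢J = cong (λ d → M i (suc k) + - d * M i (inject₁ k))
        (updateAt-minimal k J c (k≢J ∘ cong suc))

      off₂ : ∀ i k → k ≢ suc J → K i k ≡ subtractPrevious c M i k
      off₂ i k k≢J = updateAt-minimal k (suc J) (subtractPrevious c M i) k≢J

      at : ∀ i → subtractPrevious c M i (suc J) ≡
        1# * subtractPrevious c′ M i (suc J) + - c J * K i (suc J)
      at i = cong₂ _+_
        (trans (sym (vanish c′ J i (updateAt-updates J c))) (sym (*-identityˡ _)))
        (cong (- c J *_) (sym (updateAt-updates (suc J) (subtractPrevious c M i))))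


      K-adjacent : ∀ i → K i (inject₁ J) ≡ K i (suc J)
      K-adjacent i = begin
        K i (inject₁ J)
          ≡⟨ off₂ i (inject₁ J) (λ eq → ℕₚ.1+n≢n (sym (trans (sym (toℕ-inject₁ J)) (cong toℕ eq)))) ⟩
        subtractPrevious c M i (inject₁ J)
          ≡⟨ untouched J c≡0 ⟩
        M i (inject₁ J)
          ≡⟨ updateAt-updates (suc J) (subtractPrevious c M i) ⟨
        K i (suc J) ∎
        where
        untouched : ∀ (J : Fin n) → (∀ j → toℕ j ℕ.< toℕ (inject₁ J) → c j ≡ 0#) →
          subtractPrevious c M i (inject₁ J) ≡ M i (inject₁ J)
        untouched zero _ = refl
        untouched (suc J) c≡0 = vanish c (inject₁ J) i (c≡0 (inject₁ J) ℕₚ.≤-refl)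

  det-scaleRows : ∀ n (ρ : Fin n → Carrier) (M : Matrix n) →
    det R n (λ i j → ρ i * M i j) ≡ prodF ρ * det R n M
  det-scaleRows zero ρ M = sym (*-identityˡ _)
  det-scaleRows (suc n) ρ M = trans (sumF-cong term) (sumF-* (prodF ρ) (cofactorTerm M))
    where
    term : ∀ j → cofactorTerm (λ i j → ρ i * M i j) j ≡ prodF ρ * cofactorTerm M j
    term j = trans
      (cong (λ D → signℕ R (toℕ j) * (ρ zero * M zero j * D)) (det-scaleRows n (ρ ∘ suc) (minor M j)))
      (solve 5 (λ s r x P D → s :* (r :* x :* (P :* D)) := r :* P :* (s :* (x :* D))) refl _ _ _ _ _)

  det-scaleColumns : ∀ n (s : Fin n → Carrier) (M : Matrix n) →
    det R n (λ i j → s j * M i j) ≡ prodF s * det R n M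
  det-scaleColumns zero s M = sym (*-identityˡ _)
  det-scaleColumns (suc n) s M = trans (sumF-cong term) (sumF-* (prodF s) (cofactorTerm M))
    where
    term : ∀ j → cofactorTerm (λ i j → s j * M i j) j ≡ prodF s * cofactorTerm M j
    term j = begin
      ε * (s j * M zero j * det R n (minor (λ i j → s j * M i j) j))
        ≡⟨ cong (λ D → ε * (s j * M zero j * D)) (det-scaleColumns n (s ∘ punchIn j) (minor M j)) ⟩
      ε * (s j * M zero j * (prodF (s ∘ punchIn j) * det R n (minor M j)))
        ≡⟨ solve 5 (λ s r x P D → s :* (r :* x :* (P :* D)) := r :* P :* (s :* (x :* D))) refl _ _ _ _ _ ⟩
      s j * prodF (s ∘ punchIn j) * cofactorTerm M j
        ≡⟨ cong (_* cofactorTerm M j) (prodF-punchIn s j) ⟨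
      prodF s * cofactorTerm M j ∎
      where ε = signℕ R (toℕ j)

  det-lastRowZero : ∀ n (M : Matrix (suc n)) → (∀ j → M (last n) j ≡ 0#) → det R (suc n) M ≡ 0#
  det-lastRowZero zero M M≡0 = trans (cong (λ x → 1# * (x * 1#) + 0#) (M≡0 zero))
    (solve 0 (con 1 :* (con 0 :* con 1) :+ con 0 := con 0) refl)
  det-lastRowZero (suc n) M M≡0 = sumF-zero λ j → trans
    (cong (λ D → signℕ R (toℕ j) * (M zero j * D)) (det-lastRowZero n (minor M j) λ k → M≡0 (punchIn j k)))
    (solve 2 (λ s x → s :* (x :* con 0) := con 0) refl _ _)

  -- Since `det` expands along the first row, the pivot comes out by induction: term zero deletes
  -- the pivot's column and leaves a zero last row, while every other minor keeps the pivot in its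
  -- lower left corner.
  det-lastRow : ∀ n (M : Matrix (suc n)) → (∀ j → M (last n) (suc j) ≡ 0#) →
    det R (suc n) M ≡ signℕ R n * (M (last n) zero * det R n (λ i j → M (inject₁ i) (suc j)))
  det-lastRow zero M M≡0 = +-identityʳ _
  det-lastRow (suc n) M M≡0 = begin
    1# * (M zero zero * det R (suc n) (minor M zero)) + sumF R (cofactorTerm M ∘ suc)
      ≡⟨ cong₂ (λ D S → 1# * (M zero zero * D) + S) (det-lastRowZero n (minor M zero) M≡0) (sumF-cong term) ⟩
    1# * (M zero zero * 0#) + sumF R (λ j → σ * cofactorTerm N j)
      ≡⟨ solve 2 (λ x y → con 1 :* (x :* con 0) :+ y := y) refl _ _ ⟩
    sumF R (λ j → σ * cofactorTerm N j)
      ≡⟨ sumF-* σ (cofactorTerm N) ⟩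
    σ * sumF R (cofactorTerm N)
      ≡⟨ *-assoc _ _ _ ⟩
    - signℕ R n * (M (last (suc n)) zero * det R (suc n) N) ∎
    where
    N : Matrix (suc n)
    N i j = M (inject₁ i) (suc j)
    σ = - signℕ R n * M (last (suc n)) zero
    term : ∀ j → cofactorTerm M (suc j) ≡ σ * cofactorTerm N j
    term j = begin
      - s * (M zero (suc j) * det R (suc n) (minor M (suc j)))
        ≡⟨ cong (λ D → - s * (M zero (suc j) * D)) (det-lastRow n (minor M (suc j)) λ k → M≡0 (punchIn j k)) ⟩
      - s * (M zero (suc j) * (t * (x * D)))
        ≡⟨ solve 5 (λ s m t x D → s :* (m :* (t :* (x :* D))) := s :* t :* (x :* (m :* D))) refl _ _ _ _ _ ⟩
      - s * t * (x * (M zero (suc j) * D))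
        ≡⟨ cong (_* (x * (M zero (suc j) * D))) (trans (sym (-‿distribˡ-* s t))
             (trans (cong -_ (*-comm s t)) (-‿distribˡ-* t s))) ⟩
      - t * s * (x * (M zero (suc j) * D))
        ≡⟨ solve 5 (λ t s x m D → t :* s :* (x :* (m :* D)) := t :* x :* (s :* (m :* D))) refl _ _ _ _ _ ⟩
      - t * x * (s * (M zero (suc j) * D)) ∎
      where
      s = signℕ R (toℕ j)
      t = signℕ R n
      x = M (last (suc n)) zero
      D = det R n (minor N j)

-- Positive cones and multilinearity

module PositiveCone (R : RealField) where
  open Determinant R public
  open ≡-Reasoning

  -- Combinations with strictly positive coefficients and at least one term, so that a strict
  -- inequality survives multilinear expansion.
  data Cone {m} (G : ℕ → Fin m → Carrier) (S : ℕ → Set) (v : Fin m → Carrier) : Set where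
    ray : ∀ {c} k → S k → 0# < c → (∀ i → v i ≡ c * G k i) → Cone G S v
    sum : ∀ {c} {u w : Fin m → Carrier} → 0# < c → Cone G S u → Cone G S w →
      (∀ i → v i ≡ c * (u i + w i)) → Cone G S v

  Cone-resp : ∀ {m} {G : ℕ → Fin m → Carrier} {S} {u v : Fin m → Carrier} →
    (∀ i → u i ≡ v i) → Cone G S v → Cone G S u
  Cone-resp u≡v (ray k k∈S 0<c eq) = ray k k∈S 0<c λ i → trans (u≡v i) (eq i)
  Cone-resp u≡v (sum 0<c p q eq) = sum 0<c p q λ i → trans (u≡v i) (eq i)

  -- By multilinearity the determinant is a positive combination of the
  -- determinants obtained by choosing one generator per column.
  det-cone : ∀ {m} (G : ℕ → Fin m → Carrier) (S : Fin m → ℕ → Set) (σ : Carrier) →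
    (∀ κ → (∀ j → S j (κ j)) → 0# < σ * det R m (λ i j → G (κ j) i)) →
    ∀ (M : Matrix m) → (∀ j → Cone G (S j) (λ i → M i j)) → 0# < σ * det R m M
  det-cone {m} G S σ generators M₀ cone₀ =
    <-weakInduction Claim start step (last m) M₀ (λ j _ → cone₀ j)
      λ j m≤j → ⊥-elim (ℕₚ.<⇒≱ (toℕ<n j) (subst (ℕ._≤ toℕ j) (toℕ-fromℕ m) m≤j))
    where
    IsGenerator : Fin m → (Fin m → Carrier) → Set
    IsGenerator j v = Σ ℕ λ k → S j k × (∀ i → v i ≡ G k i)

    -- Columns before `p` range over their cones; those from `p` on are already generators. At
    -- `last m` the second condition is vacuous.
    Claim : Fin (suc m) → Set
    Claim p = ∀ M → (∀ j → toℕ j ℕ.< toℕ p → Cone G (S j) (λ i → M i j)) →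
      (∀ j → toℕ p ℕ.≤ toℕ j → IsGenerator j (λ i → M i j)) → 0# < σ * det R m M

    start : Claim zero
    start M _ pure = subst (λ D → 0# < σ * D)
      (det-cong m λ i j → sym (proj₂ (proj₂ (pure j z≤n)) i))
      (generators (λ j → proj₁ (pure j z≤n)) (λ j → proj₁ (proj₂ (pure j z≤n))))

    step : ∀ J → Claim (inject₁ J) → Claim (suc J)
    step J claim M cone pure = column (cone J ℕₚ.≤-refl) M (λ _ _ _ → refl) (λ _ → refl)
      where
      replace : Matrix m → (Fin m → Carrier) → Matrix m
      replace N v i = updateAt (N i) J (const (v i))

      replace-at : ∀ N v i → replace N v i J ≡ v i
      replace-at N v i = updateAt-updates J (N i)

      replace-off : ∀ N v i k → k ≢ J → replace N v i k ≡ N i k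
      replace-off N v i k k≢J = updateAt-minimal k J (N i) k≢J

      -- Recursion on the cone element in column `J`, the other columns being those of `M`: a ray is
      -- one instance of `claim`, a sum splits the determinant.
      column : ∀ {v} → Cone G (S J) v → ∀ N → (∀ i k → k ≢ J → N i k ≡ M i k) →
        (∀ i → N i J ≡ v i) → 0# < σ * det R m N
      column {v} (ray {c} k k∈S 0<c v≡cG) N N≡M N≡v =
        subst (0# <_) (sym det≡) (*-pos 0<c (claim N′ cone′ pure′))
        where
        N′ = replace N (G k)
        N′≡M : ∀ j → j ≢ J → ∀ i → N′ i j ≡ M i j
        N′≡M j j≢J i = trans (replace-off N (G k) i j j≢J) (N≡M i j j≢J)

        det≡ : σ * det R m N ≡ c * (σ * det R m N′)
        det≡ = begin
          σ * det R m N
            -- Both summands use the matrix `N′`, so the coefficient `0#` turns linearity into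
            -- scaling.
            ≡⟨ cong (σ *_) (det-linear m J c 0# (replace-off N (G k)) (replace-off N (G k)) λ i →
                 trans (N≡v i) (trans (v≡cG i) (trans (cong (c *_) (sym (replace-at N (G k) i)))
                   (solve 2 (λ x y → x := x :+ con 0 :* y) refl _ (N′ i J))))) ⟩
          σ * (c * det R m N′ + 0# * det R m N′)
            ≡⟨ solve 3 (λ s c D → s :* (c :* D :+ con 0 :* D) := c :* (s :* D)) refl σ c _ ⟩
          c * (σ * det R m N′) ∎

        cone′ : ∀ j → toℕ j ℕ.< toℕ (inject₁ J) → Cone G (S j) (λ i → N′ i j)
        cone′ j j<J = Cone-resp (N′≡M j (λ j≡J → ℕₚ.<⇒≢ j<J′ (cong toℕ j≡J))) (cone j (ℕₚ.m<n⇒m<1+n j<J′))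
          where j<J′ = subst (toℕ j ℕ.<_) (toℕ-inject₁ J) j<J

        pure′ : ∀ j → toℕ (inject₁ J) ℕ.≤ toℕ j → IsGenerator j (λ i → N′ i j)
        pure′ j J≤j with j ≟ J
        ... | yes refl = k , k∈S , replace-at N (G k)
        ... | no j≢J
          with k′ , k′∈S , eq′ ← pure j (ℕₚ.≤∧≢⇒< (subst (ℕ._≤ toℕ j) (toℕ-inject₁ J) J≤j)
                                           (λ eq → j≢J (sym (toℕ-injective eq))))
          = k′ , k′∈S , λ i → trans (N′≡M j j≢J i) (eq′ i)
      column (sum {c} {u} {w} 0<c u∈ w∈ v≡) N N≡M N≡v = subst (0# <_) (sym det≡)
        (*-pos 0<c (+-pos
          (column u∈ (replace N u) (λ i k k≢J → trans (replace-off N u i k k≢J) (N≡M i k k≢J)) (replace-at N u))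
          (column w∈ (replace N w) (λ i k k≢J → trans (replace-off N w i k k≢J) (N≡M i k k≢J)) (replace-at N w))))
        where
        det≡ : σ * det R m N ≡ c * (σ * det R m (replace N u) + σ * det R m (replace N w))
        det≡ = begin
          σ * det R m N
            ≡⟨ cong (σ *_) (det-linear m J c c (replace-off N u) (replace-off N w) λ i →
                 trans (N≡v i) (trans (v≡ i) (trans (distribˡ c _ _) (cong₂ (λ x y → c * x + c * y)
                   (sym (replace-at N u i)) (sym (replace-at N w i)))))) ⟩
          σ * (c * det R m (replace N u) + c * det R m (replace N w))
            ≡⟨ solve 4 (λ s c D E → s :* (c :* D :+ c :* E) := c :* (s :* D :+ s :* E)) refl σ c _ _ ⟩
          c * (σ * det R m (replace N u) + σ * det R m (replace N w)) ∎

-- Cauchy matrices over increasing nodes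

module NodeCauchy (R : RealField) where
  open PositiveCone R public
  open ≡-Reasoning

  Nodes : Set
  Nodes = ℕ → Carrier

  Monotone : Nodes → Set
  Monotone z = ∀ k → z k ≤ z (suc k)

  monotone-≤ : ∀ {z} → Monotone z → ∀ {k l} → k ℕ.≤ l → z k ≤ z l
  monotone-≤ mono {l = zero} z≤n = ≤-refl
  monotone-≤ mono {l = suc l} k≤l with ℕₚ.m≤n⇒m<n∨m≡n k≤l
  ... | inj₁ (s≤s k≤l′) = ≤-trans (monotone-≤ mono k≤l′) (mono l)
  ... | inj₂ refl = ≤-refl

  -- The Newton polynomial of the node sequence; at the nodes 0, 1, 2, ... it is the falling
  -- factorial.
  nodeProduct : Nodes → Carrier → ℕ → Carrier
  nodeProduct z x zero = 1#
  nodeProduct z x (suc k) = nodeProduct z x k * (x + - z k)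

  nodeProduct-pos : ∀ {z x} → Monotone z → ∀ k → z k < x → 0# < nodeProduct z x (suc k)
  nodeProduct-pos mono zero z<x = *-pos 0<1 (x<y⇒0<y-x z<x)
  nodeProduct-pos mono (suc k) z<x = *-pos (nodeProduct-pos mono k (≤-<-trans (mono k) z<x)) (x<y⇒0<y-x z<x)

  -- With the nodes z k = k this is the entry 1/(x)_{k+1} of a factorial
  -- Cauchy matrix: columns are indexed by b − 1.
  entry : Nodes → Carrier → ℕ → Carrier
  entry z x k with z k <? x
  ... | yes _ = nodeProduct z x (suc k) ⁻¹
  ... | no _ = 0#

  entry-yes : ∀ z {x} k → z k < x → entry z x k ≡ nodeProduct z x (suc k) ⁻¹
  entry-yes z {x} k z<x with z k <? x
  ... | yes _ = refl
  ... | no z≮x = ⊥-elim (z≮x z<x)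

  entry-no : ∀ z {x} k → ¬ (z k < x) → entry z x k ≡ 0#
  entry-no z {x} k z≮x with z k <? x
  ... | yes z<x = ⊥-elim (z≮x z<x)
  ... | no _ = refl

  entry-pos : ∀ {z x} → Monotone z → ∀ k → z k < x → 0# < entry z x k
  entry-pos {z} mono k z<x = subst (0# <_) (sym (entry-yes z k z<x)) (⁻¹-pos (nodeProduct-pos mono k z<x))

  entry-suc : ∀ {z x} → Monotone z → ∀ k → z (suc k) < x → entry z x k ≡ entry z x (suc k) * (x + - z (suc k))
  entry-suc {z} {x} mono k z<x = begin
    entry z x k
      ≡⟨ entry-yes z k z<x′ ⟩
    nodeProduct z x (suc k) ⁻¹
      ≡⟨ ⁻¹-factor (nodeProduct-pos mono k z<x′) (x<y⇒0<y-x z<x) ⟩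
    nodeProduct z x (suc (suc k)) ⁻¹ * (x + - z (suc k))
      ≡⟨ cong (_* (x + - z (suc k))) (entry-yes z (suc k) z<x) ⟨
    entry z x (suc k) * (x + - z (suc k)) ∎
    where z<x′ = ≤-<-trans (mono k) z<x

  zeroIndicator : Carrier → Carrier → ℕ
  zeroIndicator w x with w <? x
  ... | yes _ = 0
  ... | no _ = 1

  zeroIndicator-yes : ∀ {w x} → w < x → zeroIndicator w x ≡ 0
  zeroIndicator-yes {w} {x} w<x with w <? x
  ... | yes _ = refl
  ... | no w≮x = ⊥-elim (w≮x w<x)

  zeroIndicator-no : ∀ {w x} → ¬ (w < x) → zeroIndicator w x ≡ 1
  zeroIndicator-no {w} {x} w≮x with w <? x
  ... | yes w<x = ⊥-elim (w≮x w<x)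
  ... | no _ = refl

  -- In a monotone sequence each position is decided by comparing `x` with at most two neighbouring
  -- nodes. A node equal to `x` counts as not below it, so `x` goes in front of it, in agreement
  -- with the zero convention of `entry`.
  insert : Carrier → Nodes → Nodes
  insert x z zero with z zero <? x
  ... | yes _ = z zero
  ... | no _ = x
  insert x z (suc k) with z (suc k) <? x
  ... | yes _ = z (suc k)
  ... | no _ with z k <? x
  ...   | yes _ = x
  ...   | no _ = z k

  insert-below : ∀ {x} z k → z k < x → insert x z k ≡ z k
  insert-below {x} z zero z<x with z zero <? x
  ... | yes _ = refl
  ... | no z≮x = ⊥-elim (z≮x z<x)
  insert-below {x} z (suc k) z<x with z (suc k) <? x
  ... | yes _ = refl
  ... | no z≮x = ⊥-elim (z≮x z<x)

  insert-zero : ∀ {x} z → ¬ (z zero < x) → insert x z zero ≡ x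
  insert-zero {x} z z≮x with z zero <? x
  ... | yes z<x = ⊥-elim (z≮x z<x)
  ... | no _ = refl

  insert-between : ∀ {x} z k → z k < x → ¬ (z (suc k) < x) → insert x z (suc k) ≡ x
  insert-between {x} z k z<x z≮x with z (suc k) <? x
  ... | yes z<x′ = ⊥-elim (z≮x z<x′)
  ... | no _ with z k <? x
  ...   | yes _ = refl
  ...   | no z≮x′ = ⊥-elim (z≮x′ z<x)

  insert-above : ∀ {x z} → Monotone z → ∀ k → ¬ (z k < x) → insert x z (suc k) ≡ z k
  insert-above {x} {z} mono k z≮x with z (suc k) <? x
  ... | yes z<x′ = ⊥-elim (z≮x (≤-<-trans (mono k) z<x′))
  ... | no _ with z k <? x
  ...   | yes z<x = ⊥-elim (z≮x z<x)
  ...   | no _ = refl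

  insert-≤ : ∀ {x z} → Monotone z → ∀ k → insert x z k ≤ z k
  insert-≤ {x} {z} mono zero with z zero <? x
  ... | yes _ = ≤-refl
  ... | no z≮x = ≮⇒≥ z≮x
  insert-≤ {x} {z} mono (suc k) with z (suc k) <? x
  ... | yes _ = ≤-refl
  ... | no z≮x with z k <? x
  ...   | yes _ = ≮⇒≥ z≮x
  ...   | no _ = mono k

  insert-monotone : ∀ {x z} → Monotone z → Monotone (insert x z)
  insert-monotone {x} {z} mono k with z k <? x
  ... | no z≮x = subst (insert x z k ≤_) (sym (insert-above mono k z≮x)) (insert-≤ mono k)
  ... | yes z<x = subst (_≤ insert x z (suc k)) (sym (insert-below z k z<x)) next
    where
    next : z k ≤ insert x z (suc k)
    next with z (suc k) <? x
    ... | yes z<x′ = mono k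
    ... | no _ with z k <? x
    ...   | yes _ = inj₁ z<x
    ...   | no _ = ≤-refl

  nodeProduct-insert-below : ∀ {x z} → Monotone z → ∀ y k → z k < x →
    nodeProduct (insert x z) y (suc k) ≡ nodeProduct z y (suc k)
  nodeProduct-insert-below {x} {z} mono y zero z<x = cong (λ w → 1# * (y + - w)) (insert-below z zero z<x)
  nodeProduct-insert-below {x} {z} mono y (suc k) z<x = cong₂ (λ p w → p * (y + - w))
    (nodeProduct-insert-below mono y k (≤-<-trans (mono k) z<x)) (insert-below z (suc k) z<x)

  -- Beyond the insertion point the nodes are shifted by one and `x` is among them. In the inductive
  -- step `x` either stands just before `z (suc k)` or lies further left, where the induction
  -- hypothesis supplies it.
  nodeProduct-insert-above : ∀ {x z} → Monotone z → ∀ y k → ¬ (z k < x) →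
    nodeProduct (insert x z) y (suc (suc k)) ≡ nodeProduct z y (suc k) * (y + - x)
  nodeProduct-insert-above {x} {z} mono y zero z≮x = trans
    (cong₂ (λ v w → 1# * (y + - v) * (y + - w)) (insert-zero z z≮x) (insert-above mono zero z≮x))
    (solve 3 (λ p q r → p :* q :* r := p :* r :* q) refl 1# (y + - x) (y + - z zero))
  nodeProduct-insert-above {x} {z} mono y (suc k) z≮x with z k <? x
  ... | yes z<x = trans
    (cong₂ (λ p w → p * (y + - w))
      (cong₂ (λ p w → p * (y + - w)) (nodeProduct-insert-below mono y k z<x) (insert-between z k z<x z≮x))
      (insert-above mono (suc k) z≮x))
    (solve 3 (λ p q r → p :* q :* r := p :* r :* q) refl (nodeProduct z y (suc k)) (y + - x) (y + - z (suc k)))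
  ... | no z≮x′ = trans
    (cong₂ (λ p w → p * (y + - w)) (nodeProduct-insert-above mono y k z≮x′) (insert-above mono (suc k) z≮x))
    (solve 3 (λ p q r → p :* q :* r := p :* r :* q) refl (nodeProduct z y (suc k)) (y + - x) (y + - z (suc k)))

  entry-insert-below : ∀ {x y z} → Monotone z → x < y → ∀ k → z k < x → entry (insert x z) y k ≡ entry z y k
  entry-insert-below {x} {y} {z} mono x<y k z<x = begin
    entry (insert x z) y k
      ≡⟨ entry-yes (insert x z) k (≤-<-trans (insert-≤ mono k) z<y) ⟩
    nodeProduct (insert x z) y (suc k) ⁻¹
      ≡⟨ cong _⁻¹ (nodeProduct-insert-below mono y k z<x) ⟩
    nodeProduct z y (suc k) ⁻¹
      ≡⟨ entry-yes z k z<y ⟨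
    entry z y k ∎
    where z<y = <-trans z<x x<y

  -- The new denominator has the extra factor `y + - x`, while the node deciding about zero is still
  -- `z k`, so both sides vanish together.
  entry-insert-above : ∀ {x y z} → Monotone z → x < y → ∀ k → ¬ (z k < x) →
    entry z y k ≡ (y + - x) * entry (insert x z) y (suc k)
  entry-insert-above {x} {y} {z} mono x<y k z≮x with z k <? y
  ... | yes z<y = begin
    nodeProduct z y (suc k) ⁻¹
      ≡⟨ ⁻¹-factor (nodeProduct-pos mono k z<y) (x<y⇒0<y-x x<y) ⟩
    (nodeProduct z y (suc k) * (y + - x)) ⁻¹ * (y + - x)
      ≡⟨ *-comm _ _ ⟩
    (y + - x) * (nodeProduct z y (suc k) * (y + - x)) ⁻¹
      ≡⟨ cong (λ p → (y + - x) * p ⁻¹) (nodeProduct-insert-above mono y k z≮x) ⟨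
    (y + - x) * nodeProduct (insert x z) y (suc (suc k)) ⁻¹
      ≡⟨ cong ((y + - x) *_) (entry-yes (insert x z) (suc k) (subst (_< y) (sym (insert-above mono k z≮x)) z<y)) ⟨
    (y + - x) * entry (insert x z) y (suc k) ∎
  ... | no z≮y = sym (trans
    (cong ((y + - x) *_) (entry-no (insert x z) (suc k) (subst (λ w → ¬ (w < y)) (sym (insert-above mono k z≮x)) z≮y)))
    (zeroʳ _))

  -- Eliminating the row of the smallest point

  module _ {m x z} (mono : Monotone z) (a : Fin m → Carrier) (x<a : ∀ i → x < a i) where

    private
      G : ℕ → Fin m → Carrier
      G k i = entry (insert x z) (a i) k

      Range : ℕ → ℕ → ℕ → Set
      Range l u k = l ℕ.< k × k ℕ.≤ u

      gap : ℕ → Carrier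
      gap k = x + - z k

      gap-inverse : ∀ k → z k < x → gap k * gap k ⁻¹ ≡ 1#
      gap-inverse k z<x = ⁻¹-inverse (gap k) (<⇒≢0 (x<y⇒0<y-x z<x))

      -- Splitting `a i + - z (suc k)` into `gap (suc k)` and `a i + - x` exposes the row factor;
      -- dividing by the gap gives one telescoping step.
      entry-step : ∀ k → z (suc k) < x → ∀ i →
        entry z (a i) k ≡ entry z (a i) (suc k) * (gap (suc k) + (a i + - x))
      entry-step k z<x i = trans (entry-suc mono k (<-trans z<x (x<a i))) (cong (entry z (a i) (suc k) *_) (begin
        a i + - z (suc k)               ≡⟨ +-identityʳ _ ⟨
        a i + - z (suc k) + 0#          ≡⟨ cong (a i + - z (suc k) +_) (-‿inverseʳ x) ⟨
        a i + - z (suc k) + (x + - x)   ≡⟨ solve 4 (λ a z x y → a :+ z :+ (x :+ y) := x :+ z :+ (a :+ y)) refl _ _ _ _ ⟩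
        gap (suc k) + (a i + - x)       ∎))

    -- Telescoping: each step k → k+1 contributes a positive multiple of
    -- (a i − x) times column k+1.
    column-difference : ∀ {l u} k → l ℕ.≤ k → suc k ℕ.≤ u → z (suc k) < x →
      Σ (Fin m → Carrier) λ C → Cone G (Range l u) C ×
        (∀ i → entry z (a i) (suc k) + (a i + - x) * C i ≡ entry z x (suc k) * entry z x l ⁻¹ * entry z (a i) l)
    column-difference {l} {u} k l≤k k<u z<x with ℕₚ.m≤n⇒m<n∨m≡n l≤k
    -- A single step, `l = k`: `C` is column `suc k` divided by the gap. In the row of `x`, entry
    -- `k` equals `y * g`, so `y * g * q` is one.
    ... | inj₂ refl =
      (λ i → w * d i) ,
      ray (suc k) (ℕₚ.≤-refl , k<u) (⁻¹-pos (x<y⇒0<y-x z<x))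
        (λ i → cong (w *_) (sym (entry-insert-below mono (x<a i) (suc k) z<x))) ,
      λ i → let t = a i + - x in begin
        d i + t * (w * d i)
          ≡⟨ solve 3 (λ d t w → d :+ t :* (w :* d) := con 1 :* (con 1 :* d :+ w :* (d :* t))) refl (d i) t w ⟩
        1# * (1# * d i + w * (d i * t))
          ≡⟨ cong₂ (λ e f → e * (f * d i + w * (d i * t))) (sym ygq≡1) (sym (gap-inverse (suc k) z<x)) ⟩
        y * g * q * (g * w * d i + w * (d i * t))
          ≡⟨ solve 6 (λ y g q w d t → y :* g :* q :* (g :* w :* d :+ w :* (d :* t))
                       := g :* w :* (y :* q :* (d :* (g :+ t)))) refl y g q w (d i) t ⟩
        g * w * (y * q * (d i * (g + t)))
          ≡⟨ cong₂ _*_ (gap-inverse (suc k) z<x) (cong (y * q *_) (sym (entry-step k z<x i))) ⟩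
        1# * (y * q * entry z (a i) k)
          ≡⟨ *-identityˡ _ ⟩
        y * q * entry z (a i) k ∎
      where
      g = gap (suc k)
      w = g ⁻¹
      y = entry z x (suc k)
      q = entry z x k ⁻¹
      d : Fin m → Carrier
      d i = entry z (a i) (suc k)
      ygq≡1 : y * g * q ≡ 1#
      ygq≡1 = trans (cong (_* q) (sym (entry-suc mono k z<x)))
        (⁻¹-inverse _ (<⇒≢0 (entry-pos mono k (≤-<-trans (mono k) z<x))))
    -- The new combination is the preceding one plus column `suc (suc k)`, all divided by the new
    -- gap. In the row of `x` that gap cancels by `entry-suc`.
    column-difference {l} {u} (suc k) _ k<u z<x | inj₁ (s≤s l≤k)
      with C , C∈ , C≡ ← column-difference k l≤k (ℕₚ.<⇒≤ k<u) (≤-<-trans (mono (suc k)) z<x) =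
      (λ i → w * (1# * d i + C i)) ,
      sum (⁻¹-pos (x<y⇒0<y-x z<x))
        (ray (suc (suc k)) (s≤s (ℕₚ.m≤n⇒m≤1+n l≤k) , k<u) 0<1
          λ i → cong (1# *_) (sym (entry-insert-below mono (x<a i) (suc (suc k)) z<x)))
        C∈ (λ _ → refl) ,
      λ i → let t = a i + - x; e = entry z (a i) l in begin
        d i + t * (w * (1# * d i + C i))
          ≡⟨ solve 4 (λ d t w C → d :+ t :* (w :* (con 1 :* d :+ C)) := con 1 :* d :+ w :* (d :* t :+ t :* C)) refl (d i) t w (C i) ⟩
        1# * d i + w * (d i * t + t * C i)
          ≡⟨ cong (λ f → f * d i + w * (d i * t + t * C i)) (gap-inverse (suc (suc k)) z<x) ⟨
        g * w * d i + w * (d i * t + t * C i)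
          ≡⟨ solve 5 (λ g w d t C → g :* w :* d :+ w :* (d :* t :+ t :* C) := w :* (d :* (g :+ t) :+ t :* C)) refl g w (d i) t (C i) ⟩
        w * (d i * (g + t) + t * C i)
          ≡⟨ cong (λ f → w * (f + t * C i)) (entry-step (suc k) z<x i) ⟨
        w * (entry z (a i) (suc k) + t * C i)
          ≡⟨ cong (w *_) (C≡ i) ⟩
        w * (entry z x (suc k) * q * e)
          ≡⟨ cong (λ f → w * (f * q * e)) (entry-suc mono (suc k) z<x) ⟩
        w * (y * g * q * e)
          ≡⟨ solve 5 (λ w y g q e → w :* (y :* g :* q :* e) := g :* w :* (y :* q :* e)) refl w y g q e ⟩
        g * w * (y * q * e)
          ≡⟨ cong (_* (y * q * e)) (gap-inverse (suc (suc k)) z<x) ⟩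
        1# * (y * q * e)
          ≡⟨ *-identityˡ _ ⟩
        y * q * e ∎
      where
      g = gap (suc (suc k))
      w = g ⁻¹
      y = entry z x (suc (suc k))
      q = entry z x l ⁻¹
      d : Fin m → Carrier
      d i = entry z (a i) (suc (suc k))

    -- The columns, for the nodes with x inserted, of which column u minus
    -- its multiple of column l is built once the row of x is eliminated.
    Choice : ℕ → ℕ → ℕ → Set
    Choice l u k = (z u < x × Range l u k) ⊎ (¬ (z u < x) × k ≡ suc u)

    -- Hands the antidiagonal condition on to the smaller matrix: insertion never raises the node at
    -- a position, and a shifted index carries the old node.
    Choice-≤ : ∀ {l u k} → Choice l u k → insert x z k ≤ z u
    Choice-≤ {k = k} (inj₁ (_ , _ , k≤u)) = ≤-trans (insert-≤ mono k) (monotone-≤ mono k≤u)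
    Choice-≤ {u = u} (inj₂ (z≮x , refl)) = inj₂ (insert-above mono u z≮x)

    -- Makes the zero count independent of the choice. If `z u < x`, both entries are nonzero
    -- because `x` is below every `a i`; otherwise the deciding node is the same.
    Choice-zeroIndicator : ∀ {l u k} → Choice l u k → ∀ i →
      zeroIndicator (insert x z k) (a i) ≡ zeroIndicator (z u) (a i)
    Choice-zeroIndicator c@(inj₁ (z<x , _)) i = trans
      (zeroIndicator-yes (≤-<-trans (Choice-≤ c) z<a)) (sym (zeroIndicator-yes z<a))
      where z<a = <-trans z<x (x<a i)
    Choice-zeroIndicator {u = u} (inj₂ (z≮x , refl)) i = cong (λ w → zeroIndicator w (a i)) (insert-above mono u z≮x)

    -- Keeps the new column indices increasing. Successive ranges do not overlap, a shifted index
    -- exceeds every earlier range, shifted indices keep their order, and once a node has reached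
    -- `x` no later one is below it.
    Choice-< : ∀ {l u l′ u′ k k′} → l ℕ.< u → u ℕ.≤ l′ → l′ ℕ.< u′ → Choice l u k → Choice l′ u′ k′ → k ℕ.< k′
    Choice-< l<u u≤l′ l′<u′ (inj₁ (_ , _ , k≤u)) (inj₁ (_ , l′<k′ , _)) = ℕₚ.≤-<-trans (ℕₚ.≤-trans k≤u u≤l′) l′<k′
    Choice-< l<u u≤l′ l′<u′ (inj₁ (_ , _ , k≤u)) (inj₂ (_ , refl)) = s≤s (ℕₚ.≤-trans k≤u (ℕₚ.≤-trans u≤l′ (ℕₚ.<⇒≤ l′<u′)))
    Choice-< l<u u≤l′ l′<u′ (inj₂ (z≮x , _)) (inj₁ (z<x , _)) =
      ⊥-elim (z≮x (≤-<-trans (monotone-≤ mono (ℕₚ.≤-trans u≤l′ (ℕₚ.<⇒≤ l′<u′))) z<x))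
    Choice-< l<u u≤l′ l′<u′ (inj₂ (_ , refl)) (inj₂ (_ , refl)) = s≤s (ℕₚ.≤-<-trans u≤l′ l′<u′)

    -- The `suc` inside `signℕ` gives -1 where the row of `x` has a nonzero entry and +1 where it
    -- has a zero. The factor `a i + - x` depends only on the row.
    EliminatedColumn : ℕ → ℕ → Set
    EliminatedColumn l u = Σ (Fin m → Carrier) λ C → Cone G (Choice l u) C ×
        (∀ i → entry z (a i) u + - (entry z x u * entry z x l ⁻¹) * entry z (a i) l
             ≡ (a i + - x) * (signℕ R (suc (zeroIndicator (z u) x)) * C i))

    eliminated-column : ∀ {l u} → l ℕ.< u → EliminatedColumn l u
    eliminated-column {l} {suc k} (s≤s l≤k) = byCases (z (suc k) <? x)
      where
      byCases : Dec (z (suc k) < x) → EliminatedColumn l (suc k)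
      byCases (yes z<x) with C , C∈ , C≡ ← column-difference k l≤k ℕₚ.≤-refl z<x =
        C , weaken C∈ , λ i → let t = a i + - x; e = entry z (a i) (suc k); c = entry z x (suc k) * entry z x l ⁻¹ in begin
          e + - c * entry z (a i) l        ≡⟨ cong (e +_) (-‿distribˡ-* _ _) ⟨
          e + - (c * entry z (a i) l)      ≡⟨ cong (λ f → e + - f) (C≡ i) ⟨
          e + - (e + t * C i)              ≡⟨ cong (e +_) (-‿+-comm e (t * C i)) ⟨
          e + (- e + - (t * C i))          ≡⟨ +-assoc _ _ _ ⟨
          e + - e + - (t * C i)            ≡⟨ cong₂ _+_ (-‿inverseʳ e) (-‿distribʳ-* t (C i)) ⟩
          0# + t * - C i                   ≡⟨ +-identityˡ _ ⟩
          t * - C i                        ≡⟨ cong (λ f → t * - f) (*-identityˡ (C i)) ⟨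
          t * - (1# * C i)                 ≡⟨ cong (t *_) (-‿distribˡ-* 1# (C i)) ⟩
          t * (- 1# * C i)                 ≡⟨ cong (λ n → t * (- signℕ R n * C i)) (zeroIndicator-yes z<x) ⟨
          t * (signℕ R (suc (zeroIndicator (z (suc k)) x)) * C i) ∎
        where
        weaken : ∀ {v} → Cone G (Range l (suc k)) v → Cone G (Choice l (suc k)) v
        weaken (ray k k∈ 0<c eq) = ray k (inj₁ (z<x , k∈)) 0<c eq
        weaken (sum 0<c p q eq) = sum 0<c (weaken p) (weaken q) eq
      -- The entry in the row of `x` is zero, so nothing is subtracted; inserting `x` moves the
      -- column to the next index.
      byCases (no z≮x) = G (suc (suc k)) , ray (suc (suc k)) (inj₂ (z≮x , refl)) 0<1 (λ i → sym (*-identityˡ _)) , λ i →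
        let t = a i + - x; e = entry z (a i) (suc k); f = entry z (a i) l; q = entry z x l ⁻¹ in begin
          e + - (entry z x (suc k) * q) * f    ≡⟨ cong (λ y → e + - (y * q) * f) (entry-no z (suc k) z≮x) ⟩
          e + - (0# * q) * f                   ≡⟨ cong (λ y → e + y * f) (-‿distribʳ-* 0# q) ⟩
          e + 0# * - q * f                     ≡⟨ solve 3 (λ e q f → e :+ con 0 :* q :* f := e) refl e (- q) f ⟩
          e                                    ≡⟨ entry-insert-above mono (x<a i) (suc k) z≮x ⟩
          t * G (suc (suc k)) i                ≡⟨ cong (t *_) (*-identityˡ _) ⟨
          t * (1# * G (suc (suc k)) i)         ≡⟨ cong (λ s → t * (s * G (suc (suc k)) i)) (-‿involutive 1#) ⟨
          t * (- - 1# * G (suc (suc k)) i)     ≡⟨ cong (λ n → t * (- signℕ R n * G (suc (suc k)) i)) (zeroIndicator-no z≮x) ⟨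
          t * (signℕ R (suc (zeroIndicator (z (suc k)) x)) * G (suc (suc k)) i) ∎

-- The sign of the determinant

module DeterminantSign (R : RealField) where
  open NodeCauchy R public
  open ≡-Reasoning

  countℕ-cong : ∀ {n} {f g : Fin n → ℕ} → (∀ i → f i ≡ g i) → countℕ R f ≡ countℕ R g
  countℕ-cong {zero} f≡g = refl
  countℕ-cong {suc n} f≡g = cong₂ ℕ._+_ (f≡g zero) (countℕ-cong (f≡g ∘ suc))

  countℕ-last : ∀ {n} (f : Fin (suc n) → ℕ) → countℕ R f ≡ countℕ R (f ∘ inject₁) ℕ.+ f (last n)
  countℕ-last {zero} f = ℕₚ.+-identityʳ _
  countℕ-last {suc n} f = trans (cong (f zero ℕ.+_) (countℕ-last (f ∘ suc))) (sym (ℕₚ.+-assoc (f zero) _ _))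

  -- The `n` extra minus signs from the successors cancel the sign `signℕ R n` of the pivot's
  -- position in `det-lastRow`.
  prodF-signℕ-suc : ∀ {n} (d : Fin n → ℕ) →
    prodF (λ j → signℕ R (suc (d j))) * signℕ R n ≡ signℕ R (countℕ R d)
  prodF-signℕ-suc {zero} d = *-identityˡ _
  prodF-signℕ-suc {suc n} d = begin
    - s * P * - signℕ R n
      ≡⟨ solve 3 (λ s P t → s :* P :* t := s :* t :* P) refl (- s) P (- signℕ R n) ⟩
    - s * - signℕ R n * P
      ≡⟨ cong (_* P) (-x*-y≡x*y s (signℕ R n)) ⟩
    s * signℕ R n * P
      ≡⟨ solve 3 (λ s t P → s :* t :* P := s :* (P :* t)) refl s (signℕ R n) P ⟩
    s * (P * signℕ R n)
      ≡⟨ cong (s *_) (prodF-signℕ-suc (d ∘ suc)) ⟩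
    s * signℕ R (countℕ R (d ∘ suc))
      ≡⟨ signℕ-+ (d zero) (countℕ R (d ∘ suc)) ⟨
    signℕ R (countℕ R d) ∎
    where
    s = signℕ R (d zero)
    P = prodF (λ j → signℕ R (suc (d (suc j))))

  -- Deleting the last row and the first column leaves the antidiagonal of the smaller matrix.
  opposite-inject₁ : ∀ {n} (i : Fin n) → opposite (inject₁ i) ≡ suc (opposite i)
  opposite-inject₁ zero = refl
  opposite-inject₁ (suc i) = cong inject₁ (opposite-inject₁ i)

  opposite-last : ∀ n → opposite (last n) ≡ zero
  opposite-last zero = refl
  opposite-last (suc n) = cong inject₁ (opposite-last n)

  inject₁<last : ∀ {n} (i : Fin n) → inject₁ i <ᶠ last n
  inject₁<last {n} i = subst₂ ℕ._<_ (sym (toℕ-inject₁ i)) (sym (toℕ-fromℕ n)) (toℕ<n i)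

  inject₁<suc : ∀ {n} (i : Fin n) → inject₁ i <ᶠ suc i
  inject₁<suc i = s≤s (ℕₚ.≤-reflexive (toℕ-inject₁ i))

  suc≤inject₁ : ∀ {n} {b : Fin (suc n) → ℕ} → (∀ i j → i <ᶠ j → b i ℕ.< b j) →
    ∀ i j → i <ᶠ j → b (suc i) ℕ.≤ b (inject₁ j)
  suc≤inject₁ {b = b} inc i j i<j with ℕₚ.m≤n⇒m<n∨m≡n i<j
  ... | inj₁ si<j = ℕₚ.<⇒≤ (inc (suc i) (inject₁ j) (subst (suc (toℕ i) ℕ.<_) (sym (toℕ-inject₁ j)) si<j))
  ... | inj₂ si≡j = ℕₚ.≤-reflexive (cong b (toℕ-injective (trans si≡j (sym (toℕ-inject₁ j)))))

  zeroCount : ∀ {n} → Nodes → (Fin n → Carrier) → (Fin n → ℕ) → ℕ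
  zeroCount z a b = countℕ R (λ i → countℕ R (λ j → zeroIndicator (z (b j)) (a i)))

  -- The nodes vary in the induction because eliminating a row inserts one. The antidiagonal
  -- condition makes the bottom left entry a positive pivot, and `Choice-≤` preserves it.
  det-entry-sign : ∀ n (z : Nodes) (a : Fin n → Carrier) (b : Fin n → ℕ) → Monotone z →
    (∀ i j → i <ᶠ j → a j < a i) → (∀ i j → i <ᶠ j → b i ℕ.< b j) →
    (∀ i → z (b (opposite i)) < a i) →
    0# < signℕ R (zeroCount z a b) * det R n (λ i j → entry z (a i) (b j))
  det-entry-sign zero z a b mono dec inc anti = subst (0# <_) (sym (*-identityˡ 1#)) 0<1
  det-entry-sign (suc n) z a b mono dec inc anti =
    subst (0# <_) (sym sign≡) (*-pos (det-cone G S σ generators C C∈) (*-pos 0<pivot (prodF-pos t 0<t)))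
    where
    x = a (last n)
    a′ = a ∘ inject₁
    x<a′ : ∀ i → x < a′ i
    x<a′ i = dec (inject₁ i) (last n) (inject₁<last i)
    M : Matrix (suc n)
    M i j = entry z (a i) (b j)
    z₀<x : z (b zero) < x
    z₀<x = subst (λ j → z (b j) < x) (opposite-last n) (anti (last n))
    c : Fin n → Carrier
    c j = entry z x (b (suc j)) * entry z x (b (inject₁ j)) ⁻¹

    lastRow≡0 : ∀ j → subtractPrevious c M (last n) (suc j) ≡ 0#
    lastRow≡0 j = byCases (z (b (inject₁ j)) <? x)
      where
      y = entry z x (b (suc j))
      e = entry z x (b (inject₁ j))
      byCases : Dec (z (b (inject₁ j)) < x) → y + - (y * e ⁻¹) * e ≡ 0#
      byCases (yes z<x) = begin
        y + - (y * e ⁻¹) * e    ≡⟨ cong (y +_) (-‿distribˡ-* _ e) ⟨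
        y + - (y * e ⁻¹ * e)    ≡⟨ cong (λ w → y + - w) (trans (*-assoc y _ e) (cong (y *_) (*-comm _ e))) ⟩
        y + - (y * (e * e ⁻¹))  ≡⟨ cong (λ w → y + - (y * w)) (⁻¹-inverse e (<⇒≢0 (entry-pos mono (b (inject₁ j)) z<x))) ⟩
        y + - (y * 1#)          ≡⟨ cong (λ w → y + - w) (*-identityʳ y) ⟩
        y + - y                 ≡⟨ -‿inverseʳ y ⟩
        0#                      ∎
      -- The nodes increase, so a zero in the last row is followed only by zeros, and the difference
      -- vanishes whatever `e ⁻¹` is.
      byCases (no z≮x) = begin
        y + - (y * e ⁻¹) * e
          ≡⟨ cong₂ (λ y′ e′ → y′ + - (y * e ⁻¹) * e′)
               (entry-no z (b (suc j)) (λ z<x → z≮x (≤-<-trans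
                 (monotone-≤ mono (ℕₚ.<⇒≤ (inc (inject₁ j) (suc j) (inject₁<suc j)))) z<x)))
               (entry-no z (b (inject₁ j)) z≮x) ⟩
        0# + - (y * e ⁻¹) * 0#
          ≡⟨ solve 1 (λ w → con 0 :+ w :* con 0 := con 0) refl (- (y * e ⁻¹)) ⟩
        0# ∎

    G : ℕ → Fin n → Carrier
    G k i = entry (insert x z) (a′ i) k
    S : Fin n → ℕ → Set
    S j = Choice mono a′ x<a′ (b (inject₁ j)) (b (suc j))
    column : ∀ j → EliminatedColumn mono a′ x<a′ (b (inject₁ j)) (b (suc j))
    column j = eliminated-column mono a′ x<a′ (inc (inject₁ j) (suc j) (inject₁<suc j))
    C : Matrix n
    C i j = proj₁ (column j) i
    C∈ : ∀ j → Cone G (S j) (λ i → C i j)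
    C∈ j = proj₁ (proj₂ (column j))

    zeros : Fin n → ℕ
    zeros j = zeroIndicator (z (b (suc j))) x
    s : Fin n → Carrier
    s j = signℕ R (suc (zeros j))
    t : Fin n → Carrier
    t i = a′ i + - x
    0<t : ∀ i → 0# < t i
    0<t i = x<y⇒0<y-x (x<a′ i)
    pivot = entry z x (b zero)
    0<pivot : 0# < pivot
    0<pivot = entry-pos mono (b zero) z₀<x

    ω′ = countℕ R (λ i → countℕ R (λ j → zeroIndicator (z (b (suc j))) (a′ i)))
    σ = signℕ R ω′

    -- Every choice has zero count `ω′`, so the single sign `σ` serves all of them.
    generators : ∀ κ → (∀ j → S j (κ j)) → 0# < σ * det R n (λ i j → G (κ j) i)
    generators κ κ∈S = subst (λ m → 0# < signℕ R m * det R n (λ i j → G (κ j) i))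
      (countℕ-cong λ i → countℕ-cong λ j → Choice-zeroIndicator mono a′ x<a′ (κ∈S j) i)
      (det-entry-sign n (insert x z) a′ κ (insert-monotone mono)
        (λ i j i<j → dec (inject₁ i) (inject₁ j) (subst₂ ℕ._<_ (sym (toℕ-inject₁ i)) (sym (toℕ-inject₁ j)) i<j))
        (λ i j i<j → Choice-< mono a′ x<a′
          (inc (inject₁ i) (suc i) (inject₁<suc i)) (suc≤inject₁ inc i j i<j)
          (inc (inject₁ j) (suc j) (inject₁<suc j)) (κ∈S i) (κ∈S j))
        (λ i → ≤-<-trans (Choice-≤ mono a′ x<a′ (κ∈S (opposite i)))
          (subst (λ j → z (b j) < a′ i) (opposite-inject₁ i) (anti (inject₁ i)))))

    -- The first column has no zeros, since `z (b zero) < x` and `x` is the least point; the rest of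
    -- the last row is counted by `zeros`.
    ω≡ : zeroCount z a b ≡ ω′ ℕ.+ countℕ R zeros
    ω≡ = begin
      zeroCount z a b
        ≡⟨ countℕ-last (λ i → countℕ R (λ j → zeroIndicator (z (b j)) (a i))) ⟩
      countℕ R (λ i → countℕ R (λ j → zeroIndicator (z (b j)) (a′ i))) ℕ.+
        (zeroIndicator (z (b zero)) x ℕ.+ countℕ R zeros)
        ≡⟨ cong₂ (λ u v → u ℕ.+ (v ℕ.+ countℕ R zeros))
             (countℕ-cong λ i → cong (ℕ._+ countℕ R (λ j → zeroIndicator (z (b (suc j))) (a′ i)))
               (zeroIndicator-yes (<-trans z₀<x (x<a′ i))))
             (zeroIndicator-yes z₀<x) ⟩
      ω′ ℕ.+ countℕ R zeros ∎

    det≡ : det R (suc n) M ≡ signℕ R n * (pivot * (prodF t * (prodF s * det R n C)))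
    det≡ = begin
      det R (suc n) M
        ≡⟨ det-subtractPrevious c M ⟨
      det R (suc n) (subtractPrevious c M)
        ≡⟨ det-lastRow n (subtractPrevious c M) lastRow≡0 ⟩
      signℕ R n * (pivot * det R n (λ i j → subtractPrevious c M (inject₁ i) (suc j)))
        ≡⟨ cong (λ D → signℕ R n * (pivot * D)) (begin
             det R n (λ i j → subtractPrevious c M (inject₁ i) (suc j))
               ≡⟨ det-cong n (λ i j → proj₂ (proj₂ (column j)) i) ⟩
             det R n (λ i j → t i * (s j * C i j))
               ≡⟨ det-scaleRows n t (λ i j → s j * C i j) ⟩
             prodF t * det R n (λ i j → s j * C i j)
               ≡⟨ cong (prodF t *_) (det-scaleColumns n s C) ⟩
             prodF t * (prodF s * det R n C) ∎) ⟩
      signℕ R n * (pivot * (prodF t * (prodF s * det R n C))) ∎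

    sign≡ : signℕ R (zeroCount z a b) * det R (suc n) M ≡ σ * det R n C * (pivot * prodF t)
    sign≡ = begin
      signℕ R (zeroCount z a b) * det R (suc n) M
        ≡⟨ cong₂ _*_ (trans (cong (signℕ R) ω≡) (signℕ-+ ω′ (countℕ R zeros))) det≡ ⟩
      σ * τ * (signℕ R n * (pivot * (prodF t * (prodF s * det R n C))))
        -- Groups the column signs with the sign of the pivot's position: their product is `τ`,
        -- which cancels the `τ` from the zero count.
        ≡⟨ solve 7 (λ σ τ ε p t s D → σ :* τ :* (ε :* (p :* (t :* (s :* D))))
                     := τ :* (s :* ε) :* (σ :* D :* (p :* t))) refl σ τ (signℕ R n) pivot (prodF t) (prodF s) (det R n C) ⟩
      τ * (prodF s * signℕ R n) * (σ * det R n C * (pivot * prodF t))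
        ≡⟨ cong (λ e → τ * e * (σ * det R n C * (pivot * prodF t))) (prodF-signℕ-suc zeros) ⟩
      τ * τ * (σ * det R n C * (pivot * prodF t))
        ≡⟨ cong (_* (σ * det R n C * (pivot * prodF t))) (signℕ² (countℕ R zeros)) ⟩
      1# * (σ * det R n C * (pivot * prodF t))
        ≡⟨ *-identityˡ _ ⟩
      σ * det R n C * (pivot * prodF t) ∎
      where τ = signℕ R (countℕ R zeros)

  -- Specialisation to factorial Cauchy matrices

  nodeProduct≡falling : ∀ x k → nodeProduct (fromℕ R) x k ≡ falling R x k
  nodeProduct≡falling x zero = refl
  nodeProduct≡falling x (suc k) = cong (_* (x + - fromℕ R k)) (nodeProduct≡falling x k)

  fromℕ-monotone : Monotone (fromℕ R)
  fromℕ-monotone k = inj₁ (subst (_< 1# + fromℕ R k) (+-identityˡ _) (+-mono-< (fromℕ R k) 0<1))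

  -- Turns the threshold `b j` minus one into a node; positivity makes `pred` a true subtraction.
  fromℕ-pred : ∀ {k} → 0 ℕ.< k → fromℕ R k + - 1# ≡ fromℕ R (ℕ.pred k)
  fromℕ-pred {suc k} _ = begin
    1# + fromℕ R k + - 1#      ≡⟨ solve 3 (λ o x m → o :+ x :+ m := x :+ (o :+ m)) refl 1# (fromℕ R k) (- 1#) ⟩
    fromℕ R k + (1# + - 1#)    ≡⟨ cong (fromℕ R k +_) (-‿inverseʳ 1#) ⟩
    fromℕ R k + 0#             ≡⟨ +-identityʳ _ ⟩
    fromℕ R k                  ∎

  factorialCauchy≡entry : ∀ {n} (a : Fin n → Carrier) (b : Fin n → ℕ) → (∀ j → 0 ℕ.< b j) →
    ∀ i j → factorialCauchy R a b i j ≡ entry (fromℕ R) (a i) (ℕ.pred (b j))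
  factorialCauchy≡entry a b 0<b i j with compare (fromℕ R (b j) + - 1#) (a i)
  ... | tri< z<a _ _ = sym (trans (entry-yes (fromℕ R) (ℕ.pred (b j)) (subst (_< a i) (fromℕ-pred (0<b j)) z<a))
    (cong _⁻¹ (trans (nodeProduct≡falling (a i) (suc (ℕ.pred (b j)))) (cong (falling R (a i)) (suc-pred (0<b j))))))
    where
    suc-pred : ∀ {k} → 0 ℕ.< k → suc (ℕ.pred k) ≡ k
    suc-pred (s≤s _) = refl
  ... | tri≈ z≮a _ _ = sym (entry-no (fromℕ R) (ℕ.pred (b j)) (subst (λ w → ¬ (w < a i)) (fromℕ-pred (0<b j)) z≮a))
  ... | tri> z≮a _ _ = sym (entry-no (fromℕ R) (ℕ.pred (b j)) (subst (λ w → ¬ (w < a i)) (fromℕ-pred (0<b j)) z≮a))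

  isZero-zero : isZero R 0# ≡ 1
  isZero-zero with compare 0# 0#
  ... | tri< _ 0≢0 _ = ⊥-elim (0≢0 refl)
  ... | tri≈ _ _ _ = refl
  ... | tri> _ 0≢0 _ = ⊥-elim (0≢0 refl)

  isZero-pos : ∀ {x} → 0# < x → isZero R x ≡ 0
  isZero-pos {x} 0<x with compare x 0#
  ... | tri< _ _ _ = refl
  ... | tri≈ _ x≡0 _ = ⊥-elim (<⇒≢0 0<x x≡0)
  ... | tri> _ _ _ = refl

  -- Over increasing nodes an entry is either positive or zero by definition, so counting zeros
  -- amounts to comparing nodes.
  isZero-entry : ∀ {z} → Monotone z → ∀ x k → isZero R (entry z x k) ≡ zeroIndicator (z k) x
  isZero-entry {z} mono x k = byCases (z k <? x)
    where
    byCases : Dec (z k < x) → isZero R (entry z x k) ≡ zeroIndicator (z k) x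
    byCases (yes z<x) = trans (isZero-pos (entry-pos mono k z<x)) (sym (zeroIndicator-yes z<x))
    byCases (no z≮x) = trans (cong (isZero R) (entry-no z k z≮x)) (trans isZero-zero (sym (zeroIndicator-no z≮x)))

  factorialCauchy-sign : ∀ n (a : Fin n → Carrier) (b : Fin n → ℕ) →
    (∀ i j → i <ᶠ j → a j < a i) → (∀ i j → i <ᶠ j → b i ℕ.< b j) → (∀ j → 0 ℕ.< b j) →
    (∀ i → fromℕ R (b (opposite i)) + - 1# < a i) →
    0# < signℕ R (ω R (factorialCauchy R a b)) * det R n (factorialCauchy R a b)
  factorialCauchy-sign n a b dec inc 0<b anti = subst₂ (λ m D → 0# < signℕ R m * D)
    (countℕ-cong λ i → countℕ-cong λ j → sym (trans
      (cong (isZero R) (factorialCauchy≡entry a b 0<b i j)) (isZero-entry fromℕ-monotone (a i) (ℕ.pred (b j)))))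
    (det-cong n λ i j → sym (factorialCauchy≡entry a b 0<b i j))
    (det-entry-sign n (fromℕ R) a (ℕ.pred ∘ b) fromℕ-monotone dec
      (λ i j i<j → ℕₚ.pred-mono-< {{ℕ.>-nonZero (0<b i)}} (inc i j i<j))
      (λ i → subst (_< a i) (fromℕ-pred (0<b (opposite i))) (anti i)))

theorem4p3 : (R : RealField) → let open RealField R in
    (n : ℕ) → 1 Data.Nat.≤ n →
    (a : Fin n → Carrier) → (b : Fin n → ℕ) →
    (∀ i j → i <ᶠ j → a j < a i) →
    (∀ i j → i <ᶠ j → b i Data.Nat.< b j) →
    (∀ j → 0 Data.Nat.< b j) →
    (∀ i → _-_ R (fromℕ R (b (opposite i))) 1# < a i) →
    (∀ i j → a i ≢ _-_ R (fromℕ R (b j)) 1#) →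
    (det R n (factorialCauchy R a b) ≢ 0#)
    × (ω R (factorialCauchy R a b) % 2 ≡ 0 → 0# < det R n (factorialCauchy R a b))
    × (ω R (factorialCauchy R a b) % 2 ≡ 1 → det R n (factorialCauchy R a b) < 0#)
theorem4p3 R n _ a b dec inc 0<b anti _ = nonsingular , even , odd
  where
  open DeterminantSign R
  D = det R n (factorialCauchy R a b)
  zeros = ω R (factorialCauchy R a b)

  -- With the exponent reduced modulo two, each parity hypothesis turns the sign into `1#` or `- 1#`
  -- directly.
  signed : 0# < signℕ R (zeros % 2) * D
  signed = subst (λ s → 0# < s * D) (signℕ-parity zeros) (factorialCauchy-sign n a b dec inc 0<b anti)

  nonsingular : D ≢ 0#
  nonsingular D≡0 = <⇒≢0 signed (trans (cong (signℕ R (zeros % 2) *_) D≡0) (zeroʳ _))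

  even : zeros % 2 ≡ 0 → 0# < D
  even eq = subst (0# <_) (*-identityˡ D) (subst (λ m → 0# < signℕ R m * D) eq signed)

  odd : zeros % 2 ≡ 1 → D < 0#
  odd eq = subst (_< 0#) (-‿involutive D) (0<x⇒-x<0 (subst (0# <_)
    (trans (sym (-‿distribˡ-* 1# D)) (cong -_ (*-identityˡ D)))
    (subst (λ m → 0# < signℕ R m * D) eq signed)))
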